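{- Let $m\geq 1$. The number of descending plane partitions of dimension $m$ is $$\det\left(\binom{i+j-1}{j-1}+\delta_{i,j}-\delta_{i+1,j}\right)_{1\leq i,j\leq m-1}.$$
   Context: A descending plane partition is a (possibly empty) array $\pi=(a_{i,j})$ of positive integers with rows $i=1,\dots,k$, where row $i$ is nonempty and consists of the entries $a_{i,i},a_{i,i+1},\dots,a_{i,\mu_i}$ (so $\mu_i\geq i$ and row $i$ has length $\mu_i-i+1$), such that: (1) rows are weakly decreasing: $a_{i,j}\geq a_{i,j+1}$ for $1\leq i\leq k$ and $i\leq j<\mu_i$; (2) columns are strictly decreasing: $a_{i,j}>a_{i+1,j}$ for $1\leq i\leq k-1$ and $i<j\leq\mu_{i+1}$; (3) $a_{i,i}>\mu_i-i+1$ for $1\leq i\leq k$, i.e. the first part of each row is greater than the length of that row; (4) $a_{i,i}\leq\mu_{i-1}-(i-1)+1$ for $2\leq i\leq k$, i.e. the first part of each row is at most the length of the preceding row. (These conditions imply $\mu_1\geq\mu_2\geq\cdots\geq\mu_k\geq k$.) The empty array is a descending plane partition. The parts of $\pi$ are the numbers, with repetitions, appearing in the array. $\pi$ has dimension $m$ if no part is greater than $m$ (so the count includes the empty array). Here $\delta_{x,y}$ is the Kronecker delta, and the determinant of the empty ($0\times 0$) matrix is $1$. -}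

module Defs where

open import Data.Bool.Base using (if_then_else_)
open import Data.Fin.Base using (Fin; zero; suc; toℕ; punchIn)
open import Data.Integer.Base using (ℤ; +_; 0ℤ; 1ℤ; -1ℤ; +-0-rawMonoid) renaming (_+_ to _+ℤ_; _-_ to _-ℤ_; _*_ to _*ℤ_; _^_ to _^ℤ_)
open import Data.List.Base using (List)
open import Data.List.NonEmpty.Base using (List⁺; toList; head; tail; length)
open import Data.List.Relation.Binary.Prefix.Heterogeneous using (Prefix)
open import Data.List.Relation.Unary.All using (All)
open import Data.List.Relation.Unary.Linked using (Linked)
open import Data.Nat.Base using (ℕ; zero; suc; _+_; _∸_; _≤_; _<_; _≥_; _≡ᵇ_)
open import Data.Nat.Combinatorics using (_C_)
open import Data.Product.Base using (_×_)
open import Data.Refinement.Base using (Refinement)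
open import Algebra.Definitions.RawMonoid +-0-rawMonoid using (sum)

-- Row i is a_{i,i}, …, a_{i,μ_i}: position p (from 0) of row i is column i + p,
-- and the length of the row is μ_i - i + 1.
Row : Set
Row = List⁺ ℕ

Array : Set
Array = List Row

AllParts : (ℕ → Set) → Array → Set
AllParts P = All (λ r → All P (toList r))

-- Column j sits one position further right in row i than in row i + 1, so the
-- entries of row i + 1 are compared with the tail of row i.  The relation also
-- says that a_{i,j} exists for i < j ≤ μ_{i+1}, i.e. μ_{i+1} ≤ μ_i; in a
-- descending plane partition this is automatic, since
-- μ_{i+1} - i < a_{i+1,i+1} ≤ μ_i - i + 1.
ColumnsDecrease : Row → Row → Set
ColumnsDecrease r s = Prefix _<_ (toList s) (tail r)

record IsDescendingPlanePartition (π : Array) : Set where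
  field
    positive       : AllParts (0 <_) π
    rowsDecrease   : All (λ r → Linked _≥_ (toList r)) π
    colsDecrease   : Linked ColumnsDecrease π
    first>length   : All (λ r → length r < head r) π
    first≤previous : Linked (λ r s → head s ≤ length r) π

HasDimension : ℕ → Array → Set
HasDimension m = AllParts (_≤ m)

-- The witness is irrelevant, so equality of elements is equality of arrays.
DPP : ℕ → Set
DPP m = Refinement Array (λ π → IsDescendingPlanePartition π × HasDimension m π)

Matrix : ℕ → Set
Matrix n = Fin n → Fin n → ℤ

-- Laplace expansion along the first row.
det : ∀ {n} → Matrix n → ℤ
det {zero}  A = 1ℤ
det {suc n} A = sum λ j →
  (-1ℤ ^ℤ toℕ j) *ℤ A zero j *ℤ det (λ i k → A (suc i) (punchIn j k))

δ : ℕ → ℕ → ℤ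
δ x y = if x ≡ᵇ y then 1ℤ else 0ℤ

entry : ℕ → ℕ → ℤ
entry i j = + ((i + j ∸ 1) C (j ∸ 1)) +ℤ δ i j -ℤ δ (i + 1) j

-- Fin is 0-based, whereas the row and column indices start at 1.
dppMatrix : ∀ n → Matrix n
dppMatrix n i j = entry (suc (toℕ i)) (suc (toℕ j))

{-# OPTIONS --safe #-}
-- Put m = n + 1.  Writing e_x for the unit vectors (e_n = 0), row p (2 ≤ p ≤ m) of the matrix is
-- f_p + h(p,0), where f_p = e_{p-2} - e_{p-1} (loop below) and h(c,ℓ) is the vector of completions of an array row
-- with tail of length ℓ by parts ≤ c, so that h(0,ℓ) = e_ℓ and h(c,ℓ) = h(c-1,ℓ) + h(c,ℓ+1).
-- Expanding row p to f_p means that no row of the array starts with p, expanding it to h(p,0) starts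
-- such a row, and the recursion for h decides whether another part c is appended.  Making these
-- decisions for c = m, …, 1, and for fixed c from the last row of the array to the first, the
-- determinant and the set of descending plane partitions compatible with the decisions split in the
-- same way: a column fails to decrease strictly exactly when two rows of the matrix become equal.
-- Once all parts are decided the rows are f_p and e_ℓ, and the relation e_x = f_{x+2} + e_{x+1} shows
-- that the determinant is 1 or 0 according to the conditions on first parts and row lengths.
module Submission where

open import Algebra.Properties.AbelianGroup using (identityʳ-unique)
open import Algebra.Properties.Semiring.Sum as Sum using ()
open import Data.Bool.Base using (if_then_else_)
open import Data.Empty using (⊥)
open import Data.Fin.Base as Fin using (Fin; zero; suc; toℕ; fromℕ<; punchIn)
open import Data.Fin.Properties as FinP using (toℕ-fromℕ<; toℕ<n; toℕ-injective)
open import Data.Integer.Base using (ℤ; +_; 0ℤ; 1ℤ; -1ℤ; _+_; _*_; _-_; _^_)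
open import Data.Integer.Properties using (+-*-semiring; +-0-abelianGroup; +-identityʳ; +-identityˡ; *-identityˡ; *-zeroʳ; *-zeroˡ; *-comm)
open import Data.Integer.Solver using (module +-*-Solver)
open import Data.Irrelevant using ([_])
open import Data.List.Base as List using (List; []; _∷_; _++_; _ʳ++_; map; reverse)
open import Data.List.Membership.Propositional using (_∈_)
open import Data.List.Membership.Propositional.Properties using (∈-lookup; ∈-++⁻; ∈-++⁺ˡ; ∈-++⁺ʳ)
open import Data.List.NonEmpty.Base using (toList; head; tail; length; _∷_; _⁺++_)
open import Data.List.Properties as ListP using (length-++)
open import Data.List.Relation.Binary.Prefix.Heterogeneous using (Prefix; []; _∷_; _++ᵖ_)
open import Data.List.Relation.Binary.Prefix.Heterogeneous.Properties using (length-mono)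
open import Data.List.Relation.Unary.All as All using (All; []; _∷_)
open import Data.List.Relation.Unary.All.Properties using (map⁺; ++⁺; ++⁻ʳ)
open import Data.List.Relation.Unary.AllPairs using ([]; _∷_)
open import Data.List.Relation.Unary.Any as Any using (here; any?)
open import Data.List.Relation.Unary.Any.Properties using (lookup-index; reverse⁻)
open import Data.List.Relation.Unary.Linked as Linked using (Linked; []; [-]; _∷_; linked?)
open import Data.List.Relation.Unary.Linked.Properties using (Linked⇒All)
open import Data.List.Relation.Unary.Unique.Propositional using (Unique)
open import Data.List.Relation.Unary.Unique.Propositional.Properties using () renaming (++⁺ to Unique-++⁺)
open import Data.Nat.Base as ℕ using (ℕ; zero; suc; _∸_; _≤_; _<_; _≥_; _>_; s≤s; z≤n; _≤′_; ≤′-refl; ≤′-step)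
open import Data.Nat.Combinatorics using (_C_; nCn≡1; nCk+nC[k+1]≡[n+1]C[k+1])
open import Data.Nat.Properties as ℕP using ()
open import Data.Product.Base using (_×_; _,_; proj₁; proj₂; ∃-syntax)
open import Data.Refinement.Base using (Refinement; _,_)
open import Data.Refinement.Properties using (value-injective)
open import Data.Sum.Base using (_⊎_; inj₁; inj₂) renaming ([_,_]′ to either; map to ⊎-map)
open import Function.Base using (_∘_; flip)
open import Function.Bundles using (_↔_; mk↔ₛ′)
open import Relation.Binary.Definitions using (DecidableEquality; tri<; tri≈; tri>)
open import Relation.Binary.PropositionalEquality
open import Relation.Nullary.Decidable using (yes; no; does; dec-true; dec-false; map′; _×-dec_; recompute)
open import Relation.Nullary.Negation using (¬_; contradiction)
open import Defs

open Sum +-*-semiring using (sum; sum-cong-≗; ∑-distrib-+; *-distribˡ-sum; sum-replicate-zero)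
open +-*-Solver using (solve; _:=_; _:+_; _:*_; _:-_; con)

-- Determinants

sgn : ∀ {n} → Fin n → ℤ
sgn j = -1ℤ ^ toℕ j

sum-cong : ∀ {n} (s t : Fin n → ℤ) → s ≗ t → sum s ≡ sum t
sum-cong s t = sum-cong-≗ {_} {s} {t}

sum-zero : ∀ {n} (t : Fin n → ℤ) → (∀ j → t j ≡ 0ℤ) → sum t ≡ 0ℤ
sum-zero {n} t t≗0 = trans (sum-cong t (λ _ → 0ℤ) t≗0) (sum-replicate-zero n)

minor : ∀ {n} → Matrix (suc n) → Fin (suc n) → Matrix n
minor A j i k = A (suc i) (punchIn j k)

laplaceTerm : ∀ {n} → Matrix (suc n) → Fin (suc n) → ℤ
laplaceTerm A j = sgn j * A zero j * det (minor A j)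

det-cong : ∀ {n} {A B : Matrix n} → (∀ i j → A i j ≡ B i j) → det A ≡ det B
det-cong {zero}          A≗B = refl
det-cong {suc n} {A} {B} A≗B = sum-cong (laplaceTerm A) (laplaceTerm B) λ j →
  cong₂ (λ a d → sgn j * a * d) (A≗B zero j)
    (det-cong {A = minor A j} {minor B j} λ i k → A≗B (suc i) (punchIn j k))

det-row-+ : ∀ {n} (k : Fin n) {A B E : Matrix n} →
            (∀ i → i ≢ k → ∀ j → A i j ≡ B i j × A i j ≡ E i j) →
            (∀ j → A k j ≡ B k j + E k j) →
            det A ≡ det B + det E
det-row-+ {suc n} k {A} {B} {E} off on =
  trans (sum-cong (laplaceTerm A) (λ j → laplaceTerm B j + laplaceTerm E j) (term k off on))
        (∑-distrib-+ (laplaceTerm B) (laplaceTerm E))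
  where
  term : ∀ k → (∀ i → i ≢ k → ∀ j → A i j ≡ B i j × A i j ≡ E i j) →
         (∀ j → A k j ≡ B k j + E k j) →
         ∀ j → laplaceTerm A j ≡ laplaceTerm B j + laplaceTerm E j
  term zero off on j
    rewrite on j
          | sym (det-cong {A = minor A j} {minor B j} λ i k → proj₁ (off (suc i) (λ ()) (punchIn j k)))
          | sym (det-cong {A = minor A j} {minor E j} λ i k → proj₂ (off (suc i) (λ ()) (punchIn j k)))
    = solve 4 (λ s b c d → s :* (b :+ c) :* d := s :* b :* d :+ s :* c :* d) refl
        (sgn j) (B zero j) (E zero j) (det (minor A j))
  term (suc k) off on j
    rewrite det-row-+ k {minor A j} {minor B j} {minor E j}
              (λ i i≢k l → off (suc i) (i≢k ∘ FinP.suc-injective) (punchIn j l)) (λ l → on (punchIn j l))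
          | sym (proj₁ (off zero (λ ()) j))
          | sym (proj₂ (off zero (λ ()) j))
    = solve 4 (λ s a b c → s :* a :* (b :+ c) := s :* a :* b :+ s :* a :* c) refl
        (sgn j) (A zero j) (det (minor B j)) (det (minor E j))

-- Column selections for minors in which two columns other than 0 are deleted: column 0 survives,
-- and the rest is a selection among the other columns.
extend : ∀ {m n} → (Fin m → Fin n) → Fin (suc m) → Fin (suc n)
extend φ zero    = zero
extend φ (suc c) = suc (φ c)

-- The weight `w` of the two deleted columns and the function `M` of the surviving ones are kept
-- abstract, so that the cancellation can be iterated on fewer columns and serves several weights.
laplaceTerm₂ : ∀ {n} (w : Fin (suc (suc n)) → Fin (suc (suc n)) → ℤ)
               (M : (Fin n → Fin (suc (suc n))) → ℤ) → Fin (suc (suc n)) → Fin (suc n) → ℤ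
laplaceTerm₂ w M j k = sgn j * sgn k * w j (punchIn j k) * M (punchIn j ∘ punchIn k)

-- The term of (0, k) cancels the term of (k + 1, 0): both delete the columns 0 and k + 1.
∑∑-antisym : ∀ n (w : Fin (suc (suc n)) → Fin (suc (suc n)) → ℤ)
             (M : (Fin n → Fin (suc (suc n))) → ℤ) →
             (∀ a b → w a b ≡ w b a) → (∀ φ ψ → φ ≗ ψ → M φ ≡ M ψ) →
             sum (λ j → sum (laplaceTerm₂ w M j)) ≡ 0ℤ
∑∑-antisym n w M w-sym M-cong = begin
  sum (F zero) + sum (λ j → F (suc j) zero + inner j)
    ≡⟨ cong (λ z → sum (F zero) + z) (∑-distrib-+ (λ j → F (suc j) zero) inner) ⟩
  sum (F zero) + (sum (λ j → F (suc j) zero) + sum inner)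
    ≡⟨ cong (λ z → sum (F zero) + (sum (λ j → F (suc j) zero) + z)) (rest n w M w-sym M-cong) ⟩
  sum (F zero) + (sum (λ j → F (suc j) zero) + 0ℤ)
    ≡⟨ cong (λ z → sum (F zero) + z) (+-identityʳ (sum (λ j → F (suc j) zero))) ⟩
  sum (F zero) + sum (λ j → F (suc j) zero)
    ≡⟨ ∑-distrib-+ (F zero) (λ j → F (suc j) zero) ⟨
  sum (λ k → F zero k + F (suc k) zero)
    ≡⟨ sum-zero (λ k → F zero k + F (suc k) zero) cancel ⟩
  0ℤ ∎
  where
  open ≡-Reasoning
  F : Fin (suc (suc n)) → Fin (suc n) → ℤ
  F = laplaceTerm₂ w M
  inner : Fin (suc n) → ℤ
  inner j = sum (λ k → F (suc j) (suc k))
  cancel : ∀ k → F zero k + F (suc k) zero ≡ 0ℤ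
  cancel k rewrite w-sym zero (suc k) =
    solve 3 (λ s a b → con 1ℤ :* s :* a :* b :+ con -1ℤ :* s :* con 1ℤ :* a :* b := con 0ℤ) refl
      (sgn k) (w (suc k) zero) (M (suc ∘ punchIn k))
  -- When neither deleted column is 0, both signs flip, so their product is unchanged and the same
  -- double sum with one column fewer remains.
  rest : ∀ n (w : Fin (suc (suc n)) → Fin (suc (suc n)) → ℤ) (M : (Fin n → Fin (suc (suc n))) → ℤ) →
         (∀ a b → w a b ≡ w b a) → (∀ φ ψ → φ ≗ ψ → M φ ≡ M ψ) →
         sum (λ j → sum (λ k → laplaceTerm₂ w M (suc j) (suc k))) ≡ 0ℤ
  rest zero    w M w-sym M-cong = refl
  rest (suc n) w M w-sym M-cong = trans
    (sum-cong (λ j → sum (λ k → laplaceTerm₂ w M (suc j) (suc k))) (λ j → sum (laplaceTerm₂ w′ M′ j)) λ j →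
      sum-cong (λ k → laplaceTerm₂ w M (suc j) (suc k)) (laplaceTerm₂ w′ M′ j) λ k → cong₂ _*_
        (solve 3 (λ s t v → con -1ℤ :* s :* (con -1ℤ :* t) :* v := s :* t :* v) refl
          (sgn j) (sgn k) (w (suc j) (suc (punchIn j k))))
        (M-cong (punchIn (suc j) ∘ punchIn (suc k)) (extend (punchIn j ∘ punchIn k))
          λ { zero → refl ; (suc c) → refl }))
    (∑∑-antisym n w′ M′ (λ a b → w-sym (suc a) (suc b))
      (λ φ ψ φ≗ψ → M-cong (extend φ) (extend ψ) λ { zero → refl ; (suc c) → cong suc (φ≗ψ c) }))
    where
    w′ : Fin (suc (suc n)) → Fin (suc (suc n)) → ℤ
    w′ a b = w (suc a) (suc b)
    M′ : (Fin n → Fin (suc (suc n))) → ℤ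
    M′ φ = M (extend φ)

rows₀₁ : ∀ {n} → Matrix (suc (suc n)) → Fin (suc (suc n)) → Fin (suc (suc n)) → ℤ
rows₀₁ A a b = A zero a * A (suc zero) b

lowerMinor : ∀ {n} → Matrix (suc (suc n)) → (Fin n → Fin (suc (suc n))) → ℤ
lowerMinor A φ = det (λ i c → A (suc (suc i)) (φ c))

lowerMinor-cong : ∀ {n} (A : Matrix (suc (suc n))) φ ψ → φ ≗ ψ → lowerMinor A φ ≡ lowerMinor A ψ
lowerMinor-cong A φ ψ φ≗ψ = det-cong λ i c → cong (A (suc (suc i))) (φ≗ψ c)

det-expand₂ : ∀ {n} (A : Matrix (suc (suc n))) →
              det A ≡ sum (λ j → sum (laplaceTerm₂ (rows₀₁ A) (lowerMinor A) j))
det-expand₂ A = sum-cong (laplaceTerm A) (λ j → sum (laplaceTerm₂ (rows₀₁ A) (lowerMinor A) j)) λ j →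
  trans (*-distribˡ-sum (sgn j * A zero j) (laplaceTerm (minor A j)))
    (sum-cong (λ k → sgn j * A zero j * laplaceTerm (minor A j) k) (laplaceTerm₂ (rows₀₁ A) (lowerMinor A) j) λ k →
      solve 5 (λ s a t b d → s :* a :* (t :* b :* d) := s :* t :* (a :* b) :* d) refl
        (sgn j) (A zero j) (sgn k) (A (suc zero) (punchIn j k)) (lowerMinor A (punchIn j ∘ punchIn k)))

swap₀₁ : ∀ {n} → Matrix (suc (suc n)) → Matrix (suc (suc n))
swap₀₁ A zero          = A (suc zero)
swap₀₁ A (suc zero)    = A zero
swap₀₁ A (suc (suc i)) = A (suc (suc i))

-- The two expansions share their lower minors, and their weights add up to one that is symmetric in
-- the two columns.
det-swap₀₁ : ∀ {n} (A : Matrix (suc (suc n))) → det A + det (swap₀₁ A) ≡ 0ℤ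
det-swap₀₁ {n} A = begin
  det A + det (swap₀₁ A)
    ≡⟨ cong₂ _+_ (det-expand₂ A) (det-expand₂ (swap₀₁ A)) ⟩
  sum (λ j → sum (T A j)) + sum (λ j → sum (T (swap₀₁ A) j))
    ≡⟨ ∑-distrib-+ (λ j → sum (T A j)) (λ j → sum (T (swap₀₁ A) j)) ⟨
  sum (λ j → sum (T A j) + sum (T (swap₀₁ A) j))
    ≡⟨ sum-cong (λ j → sum (T A j) + sum (T (swap₀₁ A) j)) (λ j → sum (laplaceTerm₂ w M j)) (λ j →
         trans (sym (∑-distrib-+ (T A j) (T (swap₀₁ A) j)))
           (sum-cong (λ k → T A j k + T (swap₀₁ A) j k) (laplaceTerm₂ w M j) λ k →
             solve 4 (λ s a b d → s :* a :* d :+ s :* b :* d := s :* (a :+ b) :* d) refl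
               (sgn j * sgn k) (rows₀₁ A j (punchIn j k)) (rows₀₁ (swap₀₁ A) j (punchIn j k))
               (M (punchIn j ∘ punchIn k)))) ⟩
  sum (λ j → sum (laplaceTerm₂ w M j))
    ≡⟨ ∑∑-antisym n w M
         (λ a b → solve 4 (λ p q r s → p :* q :+ r :* s := s :* r :+ q :* p) refl
                    (A zero a) (A (suc zero) b) (A (suc zero) a) (A zero b))
         (lowerMinor-cong A) ⟩
  0ℤ ∎
  where
  open ≡-Reasoning
  T : Matrix (suc (suc n)) → Fin (suc (suc n)) → Fin (suc n) → ℤ
  T B = laplaceTerm₂ (rows₀₁ B) (lowerMinor B)
  w : Fin (suc (suc n)) → Fin (suc (suc n)) → ℤ
  w a b = rows₀₁ A a b + rows₀₁ (swap₀₁ A) a b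
  M : (Fin n → Fin (suc (suc n))) → ℤ
  M = lowerMinor A

-- Two equal rows below row 0 persist in every minor. Rows 0 and 1 give a symmetric weight. For row
-- 0 and a row further down, exchanging rows 0 and 1 moves both equal rows into the minors.
det-equalRows-< : ∀ {n} (A : Matrix n) (i k : Fin n) → i Fin.< k → (∀ j → A i j ≡ A k j) → det A ≡ 0ℤ
det-equalRows-< {suc n} A (suc i) (suc k) (s≤s i<k) eq = sum-zero (laplaceTerm A) λ j → trans
  (cong (λ z → sgn j * A zero j * z) (det-equalRows-< (minor A j) i k i<k (eq ∘ punchIn j)))
  (*-zeroʳ (sgn j * A zero j))
det-equalRows-< {suc (suc n)} A zero (suc zero) _ eq = begin
  det A
    ≡⟨ det-expand₂ A ⟩
  sum (λ j → sum (laplaceTerm₂ (rows₀₁ A) (lowerMinor A) j))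
    ≡⟨ sum-cong (λ j → sum (laplaceTerm₂ (rows₀₁ A) (lowerMinor A) j)) (λ j → sum (laplaceTerm₂ w (lowerMinor A) j)) (λ j →
         sum-cong (laplaceTerm₂ (rows₀₁ A) (lowerMinor A) j) (laplaceTerm₂ w (lowerMinor A) j) λ k →
           cong (λ b → sgn j * sgn k * (A zero j * b) * lowerMinor A (punchIn j ∘ punchIn k)) (sym (eq (punchIn j k)))) ⟩
  sum (λ j → sum (laplaceTerm₂ w (lowerMinor A) j))
    ≡⟨ ∑∑-antisym n w (lowerMinor A) (λ a b → *-comm (A zero a) (A zero b)) (lowerMinor-cong A) ⟩
  0ℤ ∎
  where
  open ≡-Reasoning
  w : Fin (suc (suc n)) → Fin (suc (suc n)) → ℤ
  w a b = A zero a * A zero b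
det-equalRows-< {suc (suc n)} A zero (suc (suc k)) _ eq = begin
  det A
    ≡⟨ +-identityʳ (det A) ⟨
  det A + 0ℤ
    ≡⟨ cong (λ z → det A + z) (sum-zero (laplaceTerm (swap₀₁ A)) λ j → trans
         (cong (λ z → sgn j * A (suc zero) j * z)
           (det-equalRows-< (minor (swap₀₁ A) j) zero (suc k) (s≤s z≤n) (eq ∘ punchIn j)))
         (*-zeroʳ (sgn j * A (suc zero) j))) ⟨
  det A + det (swap₀₁ A)
    ≡⟨ det-swap₀₁ A ⟩
  0ℤ ∎
  where open ≡-Reasoning

det-equalRows : ∀ {n} (A : Matrix n) (i k : Fin n) → i ≢ k → (∀ j → A i j ≡ A k j) → det A ≡ 0ℤ
det-equalRows A i k i≢k eq with FinP.<-cmp i k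
... | tri< i<k _ _ = det-equalRows-< A i k i<k eq
... | tri≈ _ i≡k _ = contradiction i≡k i≢k
... | tri> _ _ k<i = det-equalRows-< A k i k<i (sym ∘ eq)

-- Row vectors

-- Multiset coefficient: the number of weakly decreasing sequences of length `k` with parts from 1
-- to `c`.
mset : ℕ → ℕ → ℕ
mset zero    zero    = 1
mset zero    (suc k) = 0
mset (suc c) zero    = 1
mset (suc c) (suc k) = mset c (suc k) ℕ.+ mset (suc c) k

mset≡C : ∀ c k → mset (suc c) k ≡ (c ℕ.+ k) C k
mset≡C c       zero    = refl
mset≡C zero    (suc k) = trans (mset≡C zero k) (trans (nCn≡1 k) (sym (nCn≡1 (suc k))))
mset≡C (suc c) (suc k)
  rewrite mset≡C c (suc k) | mset≡C (suc c) k | ℕP.+-suc c k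
  = trans (ℕP.+-comm _ (suc (c ℕ.+ k) C k)) (nCk+nC[k+1]≡[n+1]C[k+1] (suc (c ℕ.+ k)) k)

RowVector : Set
RowVector = ℕ → ℤ

-- H c ℓ lists, by final column, the ways to complete a row whose tail has length ℓ with parts at most c.
H : ℕ → ℕ → RowVector
H c zero    j       = + mset c j
H c (suc ℓ) zero    = 0ℤ
H c (suc ℓ) (suc j) = H c ℓ j

-- Either all further parts are at most `c`, or the next one is `suc c`, which keeps the bound and
-- lengthens the tail by one.
H-step : ∀ c ℓ → ∀ j → H (suc c) ℓ j ≡ H c ℓ j + H (suc c) (suc ℓ) j
H-step zero    zero    zero    = refl
H-step (suc c) zero    zero    = refl
H-step c       zero    (suc j) = refl
H-step c       (suc ℓ) zero    = refl
H-step c       (suc ℓ) (suc j) = H-step c ℓ j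

H-vanishes : ∀ c ℓ j → j < ℓ → H c ℓ j ≡ 0ℤ
H-vanishes c (suc ℓ) zero    _         = refl
H-vanishes c (suc ℓ) (suc j) (s≤s j<ℓ) = H-vanishes c ℓ j j<ℓ

e : ℕ → RowVector
e = H 0

-- For `p = i + 2` this is the summand `δ i j - δ (i + 1) j` of the matrix: 1 on the diagonal, -1
-- just right of it.
loop : ℕ → RowVector
loop p j = e (p ∸ 2) j - e (p ∸ 1) j

e-step : ∀ x → ∀ j → e x j ≡ loop (2 ℕ.+ x) j + e (suc x) j
e-step x j = solve 2 (λ a b → a := a :- b :+ b) refl (e x j) (e (suc x) j)

-- Rows are indexed by the first part p ≥ 2 of the row of the array that they stand for.
Rows : Set
Rows = ℕ → RowVector

InRange : ℕ → ℕ → Set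
InRange n p = 2 ≤ p × p < 2 ℕ.+ n

-- Only columns below `n` are read, so `e n` acts as a zero row.
D : ℕ → Rows → ℤ
D n g = det {n} (λ i j → g (2 ℕ.+ toℕ i) (toℕ j))

AgreeOff : ℕ → Rows → Rows → Set
AgreeOff k g g′ = ∀ p → p ≢ k → g p ≗ g′ p

record Splits (k : ℕ) (g g₁ g₂ : Rows) : Set where
  field
    off₁ : AgreeOff k g g₁
    off₂ : AgreeOff k g g₂
    on   : ∀ j → g k j ≡ g₁ k j + g₂ k j

open Splits

D-cong : ∀ n g g′ → (∀ i → g (2 ℕ.+ i) ≗ g′ (2 ℕ.+ i)) → D n g ≡ D n g′
D-cong n g g′ g≗g′ = det-cong {n} λ i j → g≗g′ (toℕ i) (toℕ j)

index : ∀ {n} → ∀ p → InRange n p → Fin n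
index (suc (suc i)) (s≤s (s≤s _) , s≤s (s≤s i<n)) = fromℕ< i<n

toℕ-index : ∀ {n} p (r : InRange n p) → 2 ℕ.+ toℕ (index p r) ≡ p
toℕ-index (suc (suc i)) (s≤s (s≤s _) , s≤s (s≤s i<n)) = cong (2 ℕ.+_) (toℕ-fromℕ< i<n)

index-≢ : ∀ {n} k (r : InRange n k) (i : Fin n) → i ≢ index k r → 2 ℕ.+ toℕ i ≢ k
index-≢ k r i i≢k eq = i≢k (toℕ-injective (ℕP.+-cancelˡ-≡ 2 _ _ (trans eq (sym (toℕ-index k r)))))

D-split′ : ∀ {n k g g₁ g₂} → InRange n k → AgreeOff k g g₁ → AgreeOff k g g₂ →
           (∀ j → j < n → g k j ≡ g₁ k j + g₂ k j) → D n g ≡ D n g₁ + D n g₂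
D-split′ {n} {k} {g} {g₁} {g₂} r off₁ off₂ on = det-row-+ (index k r)
  (λ i i≢k j → off₁ _ (index-≢ k r i i≢k) (toℕ j) , off₂ _ (index-≢ k r i i≢k) (toℕ j))
  (λ j → subst (λ p → g p (toℕ j) ≡ g₁ p (toℕ j) + g₂ p (toℕ j)) (sym (toℕ-index k r)) (on (toℕ j) (toℕ<n j)))

D-split : ∀ {n k g g₁ g₂} → InRange n k → Splits k g g₁ g₂ → D n g ≡ D n g₁ + D n g₂
D-split r s = D-split′ r (off₁ s) (off₂ s) (λ j _ → on s j)

-- A zero row is its own sum with itself, so additivity makes the determinant equal to its double.
D-zeroRow : ∀ {n k g} → InRange n k → (∀ j → j < n → g k j ≡ 0ℤ) → D n g ≡ 0ℤ
D-zeroRow {n} {k} {g} r z = identityʳ-unique +-0-abelianGroup (D n g) (D n g) (sym doubled)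
  where
  doubled : D n g ≡ D n g + D n g
  doubled = D-split′ {g = g} {g} {g} r (λ _ _ _ → refl) (λ _ _ _ → refl) (λ j j<n → trans (z j j<n) (sym (cong₂ _+_ (z j j<n) (z j j<n))))

D-equalRows : ∀ {n k l g} → InRange n k → InRange n l → k ≢ l → g k ≗ g l → D n g ≡ 0ℤ
D-equalRows {n} {k} {l} {g} rk rl k≢l eq = det-equalRows _ (index k rk) (index l rl)
  (λ ik≡il → k≢l (trans (sym (toℕ-index k rk)) (trans (cong (λ i → 2 ℕ.+ toℕ i) ik≡il) (toℕ-index l rl))))
  (λ j → trans (cong (λ p → g p (toℕ j)) (toℕ-index k rk))
    (trans (eq (toℕ j)) (cong (λ p → g p (toℕ j)) (sym (toℕ-index l rl)))))

infix 9 _[_≔_]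
_[_≔_] : Rows → ℕ → RowVector → Rows
(g [ k ≔ v ]) p = if does (p ℕP.≟ k) then v else g p

≔-same : ∀ g k v → (g [ k ≔ v ]) k ≡ v
≔-same g k v rewrite dec-true (k ℕP.≟ k) refl = refl

≔-other : ∀ g k v {p} → p ≢ k → (g [ k ≔ v ]) p ≡ g p
≔-other g k v {p} p≢k rewrite dec-false (p ℕP.≟ k) p≢k = refl

≔-agree : ∀ g k v → AgreeOff k g (g [ k ≔ v ])
≔-agree g k v p p≢k j = cong (λ u → u j) (sym (≔-other g k v p≢k))

≔-on : ∀ g k v → (g [ k ≔ v ]) k ≗ v
≔-on g k v j = cong (λ u → u j) (≔-same g k v)

-- Sliding unit vectors along loop rows

Free : ℕ → Rows → ℕ → ℕ → Set
Free k g x y = ∀ p → x ≤ p → p < y → p ≢ k × g p ≗ loop p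

-- A row e x equals loop (2 + x) + e (x + 1), and the first summand repeats row 2 + x.
D-slide : ∀ {n k x y g g′} → InRange n k → x ≤ y → y ≤ n → Free k g (2 ℕ.+ x) (2 ℕ.+ y) →
          AgreeOff k g g′ → g k ≗ e x → g′ k ≗ e y → D n g ≡ D n g′
D-slide {n} {k} {x} {y} {g} {g′} r x≤y = go (ℕP.≤⇒≤′ x≤y)
  where
  go : ∀ {y g′} → x ≤′ y → y ≤ n → Free k g (2 ℕ.+ x) (2 ℕ.+ y) →
       AgreeOff k g g′ → g k ≗ e x → g′ k ≗ e y → D n g ≡ D n g′
  go {g′ = g′} ≤′-refl y≤n free agree gk g′k = D-cong n g g′ (λ i → pointwise (2 ℕ.+ i))
    where
    pointwise : ∀ p → g p ≗ g′ p
    pointwise p j with p ℕP.≟ k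
    ... | yes refl = trans (gk j) (sym (g′k j))
    ... | no p≢k   = agree p p≢k j
  go {suc y} {g′} (≤′-step x≤y) y<n free agree gk g′k = begin
    D n g
      ≡⟨ go x≤y (ℕP.≤-trans (ℕP.n≤1+n y) y<n) (λ p x≤p p<y → free p x≤p (ℕP.m≤n⇒m≤1+n p<y))
           (≔-agree g k (e y)) gk (≔-on g k (e y)) ⟩
    D n g₀
      ≡⟨ D-split r (record { off₁ = agree₀₁ ; off₂ = agree₀₂ ; on = on₀ }) ⟩
    D n g₁ + D n g′
      ≡⟨ cong (λ z → z + D n g′) (D-equalRows {g = g₁} r ry (proj₁ freeʸ ∘ sym) (λ j →
           trans (≔-on g k (loop (2 ℕ.+ y)) j)
             (trans (sym (proj₂ freeʸ j)) (≔-agree g k (loop (2 ℕ.+ y)) _ (proj₁ freeʸ) j)))) ⟩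
    0ℤ + D n g′
      ≡⟨ +-identityˡ _ ⟩
    D n g′ ∎
    where
    open ≡-Reasoning
    g₀ = g [ k ≔ e y ]
    g₁ = g [ k ≔ loop (2 ℕ.+ y) ]
    ry : InRange n (2 ℕ.+ y)
    ry = s≤s (s≤s z≤n) , s≤s (s≤s y<n)
    freeʸ = free (2 ℕ.+ y) (s≤s (s≤s (ℕP.≤′⇒≤ x≤y))) ℕP.≤-refl
    agree₀₁ : AgreeOff k g₀ g₁
    agree₀₁ p p≢k j = trans (sym (≔-agree g k (e y) p p≢k j)) (≔-agree g k (loop (2 ℕ.+ y)) p p≢k j)
    agree₀₂ : AgreeOff k g₀ g′
    agree₀₂ p p≢k j = trans (sym (≔-agree g k (e y) p p≢k j)) (agree p p≢k j)
    on₀ : ∀ j → g₀ k j ≡ g₁ k j + g′ k j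
    on₀ j = trans (≔-on g k (e y) j) (trans (e-step y j)
      (sym (cong₂ _+_ (≔-on g k (loop (2 ℕ.+ y)) j) (g′k j))))

-- The unit vector slides as far as `e n`, which vanishes in all columns of the matrix.
D-slideOff : ∀ {n k x g} → InRange n k → x ≤ n → Free k g (2 ℕ.+ x) (2 ℕ.+ n) → g k ≗ e x → D n g ≡ 0ℤ
D-slideOff {n} {k} {x} {g} r x≤n free gk =
  trans (D-slide {g′ = g [ k ≔ e n ]} r x≤n ℕP.≤-refl free (≔-agree g k (e n)) gk (≔-on g k (e n)))
    (D-zeroRow {g = g [ k ≔ e n ]} r λ j j<n → trans (≔-on g k (e n) j) (H-vanishes 0 n j j<n))

-- The matrix is unitriangular. Row 2 may be replaced by `e 0`, because the difference `e 1` slides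
-- off; expanding along `e 0` then lowers the size by one.
D-loop : ∀ n → D n loop ≡ 1ℤ
D-loop zero    = refl
D-loop (suc n) = begin
  D (suc n) loop
    ≡⟨ +-identityʳ _ ⟨
  D (suc n) loop + 0ℤ
    ≡⟨ cong (λ z → D (suc n) loop + z) (D-slideOff {g = g₁} r (s≤s z≤n) free (≔-on loop 2 (e 1))) ⟨
  D (suc n) loop + D (suc n) g₁
    ≡⟨ D-split r (record { off₁ = λ p p≢2 j → sym (≔-agree loop 2 (e 0) p p≢2 j)
                         ; off₂ = λ p p≢2 j → trans (sym (≔-agree loop 2 (e 0) p p≢2 j)) (≔-agree loop 2 (e 1) p p≢2 j)
                         ; on   = e-step 0 }) ⟨
  D (suc n) g₀
    -- Shifting row and column index together does not change a loop entry, so the first minor is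
    -- `D n loop` by computation; the other entries of row 2 are 0.
    ≡⟨ cong₂ _+_ (*-identityˡ (D n loop)) (sum-zero (laplaceTerm A ∘ suc) λ j →
         trans (cong (λ z → z * det (minor A (suc j))) (*-zeroʳ (sgn (suc j)))) (*-zeroˡ (det (minor A (suc j))))) ⟩
  D n loop + 0ℤ
    ≡⟨ +-identityʳ _ ⟩
  D n loop
    ≡⟨ D-loop n ⟩
  1ℤ ∎
  where
  open ≡-Reasoning
  g₀ = loop [ 2 ≔ e 0 ]
  g₁ = loop [ 2 ≔ e 1 ]
  A : Matrix (suc n)
  A i j = g₀ (2 ℕ.+ toℕ i) (toℕ j)
  r : InRange (suc n) 2
  r = s≤s (s≤s z≤n) , s≤s (s≤s (s≤s z≤n))
  free : Free 2 g₁ 3 (3 ℕ.+ n)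
  free p 3≤p _ = p≢2 , λ j → sym (≔-agree loop 2 (e 1) p p≢2 j)
    where
    p≢2 : p ≢ 2
    p≢2 = ℕP.<⇒≢ 3≤p ∘ sym

-- The matrix with some first parts decided

undecided : ℕ → RowVector
undecided p j = loop p j + H p 0 j

-- Rows `p ≤ c` still carry both options; a row above `c` is a loop row unless `stateRows`
-- overwrites it.
base : ℕ → Rows
base c p = if does (p ℕP.≤? c) then undecided p else loop p

base-≤ : ∀ {c p} → p ≤ c → base c p ≡ undecided p
base-≤ {c} {p} p≤c rewrite dec-true (p ℕP.≤? c) p≤c = refl

base-≰ : ∀ {c p} → ¬ p ≤ c → base c p ≡ loop p
base-≰ {c} {p} p≰c rewrite dec-false (p ℕP.≤? c) p≰c = refl

-- Either no row of the array starts with `suc c`, or one does and its tail is still empty.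
base-splits : ∀ c → Splits (suc c) (base (suc c)) (base c) (base c [ suc c ≔ H (suc c) 0 ])
base-splits c = record
  { off₁ = agree
  ; off₂ = λ p p≢ j → trans (agree p p≢ j) (≔-agree (base c) (suc c) (H (suc c) 0) p p≢ j)
  ; on   = λ j → trans (cong (λ u → u j) (base-≤ {suc c} {suc c} ℕP.≤-refl))
             (sym (cong₂ _+_ (cong (λ u → u j) (base-≰ {c} {suc c} (ℕP.<⇒≱ (ℕP.n<1+n c))))
                             (≔-on (base c) (suc c) (H (suc c) 0) j)))
  }
  where
  agree : AgreeOff (suc c) (base (suc c)) (base c)
  agree p p≢ j with p ℕP.≤? c
  ... | yes p≤c = cong (λ u → u j) (trans (base-≤ {suc c} (ℕP.m≤n⇒m≤1+n p≤c)) (sym (base-≤ p≤c)))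
  ... | no p≰c  = cong (λ u → u j) (trans
    (base-≰ {suc c} (λ p≤1+c → p≰c (ℕ.s≤s⁻¹ (ℕP.≤∧≢⇒< p≤1+c p≢)))) (sym (base-≰ p≰c)))

-- Partially known arrays

-- The size is an integer so that it can be equated with a determinant and follow its splittings;
-- the explicit list later provides the bijection.
record Counted (P : Array → Set) (z : ℤ) : Set where
  field
    arrays   : List Array
    unique   : Unique arrays
    sound    : ∀ {π} → π ∈ arrays → P π
    complete : ∀ {π} → P π → π ∈ arrays
    size     : + List.length arrays ≡ z

module _ {P : Array → Set} where

  open Counted

  counted-⊎ : ∀ {P₁ P₂ : Array → Set} {z₁ z₂} → (∀ {π} → P π → P₁ π ⊎ P₂ π) →
              (∀ {π} → P₁ π → P π) → (∀ {π} → P₂ π → P π) → (∀ {π} → P₁ π → P₂ π → ⊥) →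
              Counted P₁ z₁ → Counted P₂ z₂ → Counted P (z₁ + z₂)
  counted-⊎ to from₁ from₂ disjoint C₁ C₂ = record
    { arrays   = arrays C₁ ++ arrays C₂
    ; unique   = Unique-++⁺ (unique C₁) (unique C₂) (λ (π∈₁ , π∈₂) → disjoint (sound C₁ π∈₁) (sound C₂ π∈₂))
    ; sound    = λ π∈ → either (from₁ ∘ sound C₁) (from₂ ∘ sound C₂) (∈-++⁻ (arrays C₁) π∈)
    ; complete = λ Pπ → either (∈-++⁺ˡ ∘ complete C₁) (∈-++⁺ʳ (arrays C₁) ∘ complete C₂) (to Pπ)
    ; size     = trans (cong +_ (length-++ (arrays C₁))) (cong₂ _+_ (size C₁) (size C₂))
    }

  counted-∅ : (∀ {π} → ¬ P π) → Counted P 0ℤ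
  counted-∅ ¬P = record
    { arrays = [] ; unique = [] ; sound = λ () ; complete = λ Pπ → contradiction Pπ ¬P ; size = refl }

  counted-singleton : ∀ {π₀} → P π₀ → (∀ {π} → P π → π ≡ π₀) → Counted P 1ℤ
  counted-singleton {π₀} Pπ₀ only = record
    { arrays   = π₀ ∷ []
    ; unique   = [] ∷ []
    ; sound    = λ { (here refl) → Pπ₀ }
    ; complete = λ Pπ → here (only Pπ)
    ; size     = refl
    }

  counted-⇔ : ∀ {P′ : Array → Set} {z} → (∀ {π} → P π → P′ π) → (∀ {π} → P′ π → P π) → Counted P′ z → Counted P z
  counted-⇔ to from E = record
    { arrays = arrays E ; unique = unique E ; sound = from ∘ sound E ; complete = complete E ∘ to ; size = size E }

-- A row known so far, together with a bound on its further parts.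
Slot : Set
Slot = Row × ℕ

Grows : ℕ → Row → Row → Set
Grows c r s = ∃[ ys ] s ≡ r ⁺++ ys × Linked _≥_ (c ∷ ys)

-- Linked _>_ (suc c ∷ …): the rows not listed in the slots have decreasing first parts, all at most c.
data Extends (c : ℕ) : List Slot → Array → Set where
  stop : ∀ {π} → Linked _>_ (suc c ∷ map head π) → All (Linked _≥_ ∘ toList) π → Extends c [] π
  _∷_  : ∀ {r b s σ π} → Grows b r s → Extends c σ π → Extends c ((r , b) ∷ σ) (s ∷ π)

vector : Slot → RowVector
vector (r , c) = H c (List.length (tail r))

stateRows : ℕ → List Slot → Rows
stateRows c []      = base c
stateRows c (s ∷ σ) = stateRows c σ [ head (proj₁ s) ≔ vector s ]

linked-weaken : ∀ {c ys} → Linked _≥_ (c ∷ ys) → Linked _≥_ (suc c ∷ ys)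
linked-weaken [-]      = [-]
linked-weaken (p ∷ ps) = ℕP.m≤n⇒m≤1+n p ∷ ps

⁺++-assoc : ∀ (r : Row) xs ys → (r ⁺++ xs) ⁺++ ys ≡ r ⁺++ (xs ++ ys)
⁺++-assoc (a ∷ as) xs ys = cong (a ∷_) (ListP.++-assoc as xs ys)

⁺++-cancelˡ : ∀ (r : Row) xs ys → r ⁺++ xs ≡ r ⁺++ ys → xs ≡ ys
⁺++-cancelˡ (a ∷ as) xs ys eq = ListP.++-cancelˡ as xs ys (cong tail eq)

-- Counterpart of `H-step` on the side of the arrays: the next part, if any, is at most `c` or
-- equals `suc c`.
grows-split : ∀ {c r s} → Grows (suc c) r s → Grows c r s ⊎ Grows (suc c) (r ⁺++ (suc c ∷ [])) s
grows-split ([] , eq , _) = inj₁ ([] , eq , [-])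
grows-split {c} {r} (y ∷ ys , eq , y≤1+c ∷ lk) with ℕP.m≤n⇒m<n∨m≡n y≤1+c
... | inj₁ (s≤s y≤c) = inj₁ (y ∷ ys , eq , y≤c ∷ lk)
... | inj₂ refl      = inj₂ (ys , trans eq (sym (⁺++-assoc r (y ∷ []) ys)) , lk)

grows-weaken : ∀ {c r s} → Grows c r s → Grows (suc c) r s
grows-weaken (ys , eq , lk) = ys , eq , linked-weaken lk

grows-shorten : ∀ {c r s} → Grows (suc c) (r ⁺++ (suc c ∷ [])) s → Grows (suc c) r s
grows-shorten {c} {r} (ys , eq , lk) = suc c ∷ ys , trans eq (⁺++-assoc r (suc c ∷ []) ys) , ℕP.≤-refl ∷ lk

grows-disjoint : ∀ {c r s} → Grows c r s → ¬ Grows (suc c) (r ⁺++ (suc c ∷ [])) s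
grows-disjoint {c} {r} (ys , eq , lk) (zs , eq′ , _)
  with refl ← ⁺++-cancelˡ r ys (suc c ∷ zs) (trans (sym eq) (trans eq′ (⁺++-assoc r (suc c ∷ []) zs)))
  with c≥1+c ∷ _ ← lk = ℕP.1+n≰n c≥1+c

-- One decision seen from both sides: the arrays fall into two disjoint classes while row `k` of the
-- matrix splits into two summands.
record StateSplits (k : ℕ) (c : ℕ) (σ : List Slot) (c₁ : ℕ) (σ₁ : List Slot) (c₂ : ℕ) (σ₂ : List Slot) : Set where
  field
    to       : ∀ {π} → Extends c σ π → Extends c₁ σ₁ π ⊎ Extends c₂ σ₂ π
    from₁    : ∀ {π} → Extends c₁ σ₁ π → Extends c σ π
    from₂    : ∀ {π} → Extends c₂ σ₂ π → Extends c σ π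
    disjoint : ∀ {π} → Extends c₁ σ₁ π → Extends c₂ σ₂ π → ⊥
    splits   : Splits k (stateRows c σ) (stateRows c₁ σ₁) (stateRows c₂ σ₂)

splits-≔ : ∀ {k l g g₁ g₂} v → k ≢ l → Splits k g g₁ g₂ → Splits k (g [ l ≔ v ]) (g₁ [ l ≔ v ]) (g₂ [ l ≔ v ])
splits-≔ {k} {l} {g} {g₁} {g₂} v k≢l S = record
  { off₁ = λ p p≢k → off g g₁ p (Splits.off₁ S p p≢k)
  ; off₂ = λ p p≢k → off g g₂ p (Splits.off₂ S p p≢k)
  ; on   = λ j → trans (sym (≔-agree g l v k k≢l j)) (trans (Splits.on S j)
             (cong₂ _+_ (≔-agree g₁ l v k k≢l j) (≔-agree g₂ l v k k≢l j)))
  }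
  where
  off : ∀ g g′ p → g p ≗ g′ p → (g [ l ≔ v ]) p ≗ (g′ [ l ≔ v ]) p
  off g g′ p eq j with p ℕP.≟ l
  ... | yes refl = trans (≔-on g l v j) (sym (≔-on g′ l v j))
  ... | no p≢l   = trans (sym (≔-agree g l v p p≢l j)) (trans (eq j) (≔-agree g′ l v p p≢l j))

stateSplits-∷ : ∀ {k c σ c₁ σ₁ c₂ σ₂} (t : Slot) → k ≢ head (proj₁ t) →
                StateSplits k c σ c₁ σ₁ c₂ σ₂ → StateSplits k c (t ∷ σ) c₁ (t ∷ σ₁) c₂ (t ∷ σ₂)
stateSplits-∷ t k≢ S = record
  { to       = λ { (g ∷ x) → ⊎-map (g ∷_) (g ∷_) (to x) }
  ; from₁    = λ { (g ∷ x) → g ∷ from₁ x }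
  ; from₂    = λ { (g ∷ x) → g ∷ from₂ x }
  ; disjoint = λ { (_ ∷ x) (_ ∷ y) → disjoint x y }
  ; splits   = splits-≔ (vector t) k≢ splits
  }
  where open StateSplits S

-- The slots `τ` above the decision are listed nearest first, as in a zipper, hence the reversed
-- append.
stateSplits-ʳ++ : ∀ {k c σ c₁ σ₁ c₂ σ₂} (τ : List Slot) → All (λ t → k ≢ head (proj₁ t)) τ →
                  StateSplits k c σ c₁ σ₁ c₂ σ₂ → StateSplits k c (τ ʳ++ σ) c₁ (τ ʳ++ σ₁) c₂ (τ ʳ++ σ₂)
stateSplits-ʳ++ []      []         S = S
stateSplits-ʳ++ (t ∷ τ) (k≢ ∷ k≢s) S = stateSplits-ʳ++ τ k≢s (stateSplits-∷ t k≢ S)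

stateRows-ʳ++ : ∀ {c σ k} (τ : List Slot) → All (λ t → k ≢ head (proj₁ t)) τ → stateRows c (τ ʳ++ σ) k ≡ stateRows c σ k
stateRows-ʳ++ []      []         = refl
stateRows-ʳ++ {c} {σ} (t ∷ τ) (k≢ ∷ k≢s) = trans (stateRows-ʳ++ τ k≢s) (≔-other (stateRows c σ) (head (proj₁ t)) (vector t) k≢)

row-splits : ∀ c r c₀ σ →
             StateSplits (head r) c₀ ((r , suc c) ∷ σ) c₀ ((r , c) ∷ σ) c₀ ((r ⁺++ (suc c ∷ []) , suc c) ∷ σ)
row-splits c r c₀ σ = record
  { to       = λ { (g ∷ x) → ⊎-map (_∷ x) (_∷ x) (grows-split g) }
  ; from₁    = λ { (g ∷ x) → grows-weaken g ∷ x }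
  ; from₂    = λ { (g ∷ x) → grows-shorten g ∷ x }
  ; disjoint = λ { (g ∷ _) (g′ ∷ _) → grows-disjoint g g′ }
  ; splits   = record
    { off₁ = off
    ; off₂ = off
    ; on   = λ j → trans (≔-on (stateRows c₀ σ) k (H (suc c) ℓ) j) (trans (H-step c ℓ j) (sym (cong₂ _+_
               (≔-on (stateRows c₀ σ) k (H c ℓ) j)
               (trans (≔-on (stateRows c₀ σ) k (H (suc c) (List.length (tail r ++ (suc c ∷ [])))) j)
                 (cong (λ l → H (suc c) l j) (trans (length-++ (tail r)) (ℕP.+-comm ℓ 1)))))))
    }
  }
  where
  k = head r
  ℓ = List.length (tail r)
  off : ∀ {v w} → AgreeOff k (stateRows c₀ σ [ k ≔ v ]) (stateRows c₀ σ [ k ≔ w ])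
  off {v} {w} p p≢k j = trans (sym (≔-agree (stateRows c₀ σ) k v p p≢k j)) (≔-agree (stateRows c₀ σ) k w p p≢k j)

linked-strengthen : ∀ {c} {as} → Linked _>_ (suc c ∷ as) → Linked _>_ (suc (suc c) ∷ as)
linked-strengthen [-]      = [-]
linked-strengthen (p ∷ ps) = ℕP.m≤n⇒m≤1+n p ∷ ps

-- Counterpart of `base-splits`: first parts decrease, so only the first unlisted row can start with
-- `suc c`, and if it does it becomes a new slot.
newRow-splits : ∀ c → StateSplits (suc c) (suc c) [] c [] c (((suc c ∷ []) , suc c) ∷ [])
newRow-splits c = record
  { to       = to
  ; from₁    = λ { (stop hs rs) → stop (linked-strengthen hs) rs }
  ; from₂    = λ { ((ys , refl , lk) ∷ stop hs rs) → stop (ℕP.≤-refl ∷ hs) (lk ∷ rs) }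
  ; disjoint = λ { (stop (1+c>1+c ∷ _) _) ((ys , refl , _) ∷ _) → ℕP.1+n≰n 1+c>1+c }
  ; splits   = base-splits c
  }
  where
  to : ∀ {π} → Extends (suc c) [] π → Extends c [] π ⊎ Extends c (((suc c ∷ []) , suc c) ∷ []) π
  to (stop {[]} _ _) = inj₁ (stop [-] [])
  to (stop {(a ∷ as) ∷ π} (s≤s a≤1+c ∷ hs) (r ∷ rs)) with ℕP.m≤n⇒m<n∨m≡n a≤1+c
  ... | inj₁ a<1+c = inj₁ (stop (a<1+c ∷ hs) (r ∷ rs))
  ... | inj₂ refl  = inj₂ ((as , refl , r) ∷ stop hs rs)

extends-row : ∀ {P : Row → Set} {c r b σ π} (τ : List Slot) → Extends c (τ ʳ++ ((r , b) ∷ σ)) π → All P π →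
              ∃[ s ] Grows b r s × P s
extends-row {P} τ = go τ λ { (g ∷ _) (p ∷ _) → _ , g , p }
  where
  go : ∀ {c X r b π} (τ : List Slot) → (∀ {π} → Extends c X π → All P π → ∃[ s ] Grows b r s × P s) →
       Extends c (τ ʳ++ X) π → All P π → ∃[ s ] Grows b r s × P s
  go []      f = f
  go (t ∷ τ) f = go τ λ { (_ ∷ x) (_ ∷ ps) → f x ps }

extends-adjacent : ∀ {R : Row → Row → Set} {c r b r′ b′ σ π} (τ : List Slot) →
                   Extends c (τ ʳ++ ((r , b) ∷ (r′ , b′) ∷ σ)) π → Linked R π →
                   ∃[ s ] ∃[ s′ ] Grows b r s × Grows b′ r′ s′ × R s s′
extends-adjacent {R} τ = go τ λ { (g ∷ (g′ ∷ _)) (x ∷ _) → _ , _ , g , g′ , x }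
  where
  go : ∀ {c X r b r′ b′ π} (τ : List Slot) →
       (∀ {π} → Extends c X π → Linked R π → ∃[ s ] ∃[ s′ ] Grows b r s × Grows b′ r′ s′ × R s s′) →
       Extends c (τ ʳ++ X) π → Linked R π → ∃[ s ] ∃[ s′ ] Grows b r s × Grows b′ r′ s′ × R s s′
  go []      f = f
  go (t ∷ τ) f = go τ λ { (_ ∷ x) lk → f x (Linked.tail lk) }

-- Strict columns require an entry of `ys` above `x`, but all entries of `ys` are at most `x`.
collision : ∀ {x} xs {us ys zs} → List.length xs ≡ List.length us → Prefix _<_ (xs ++ x ∷ zs) (us ++ ys) →
            ¬ Linked _≥_ (x ∷ ys)
collision []       {[]}     eq (x<y ∷ _) (x≥y ∷ _) = ℕP.<⇒≱ x<y x≥y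
collision (_ ∷ xs) {_ ∷ us} eq (_ ∷ ps)  lk        = collision xs (ℕP.suc-injective eq) ps lk

-- Fully known arrays

atCap : ℕ → Array → List Slot
atCap c = map (_, c)

-- The consequences of strict columns that suffice to evaluate the determinant of a fully known
-- array.
Below : Row → Row → Set
Below r s = head s < head r × List.length (tail s) < List.length (tail r)

FirstAtMostLength : Row → Row → Set
FirstAtMostLength r s = head s ≤ length r

heads-< : ∀ {p s ρ} → Linked Below (s ∷ ρ) → head s < p → All (λ u → head u < p) (s ∷ ρ)
heads-< [-]                   s<p = s<p ∷ []
heads-< ((u<s , _) ∷ ordered) s<p = s<p ∷ heads-< ordered (ℕP.<-trans u<s s<p)

tail-heads-< : ∀ {p r ρ} → Linked Below (r ∷ ρ) → (∀ {s ρ′} → ρ ≡ s ∷ ρ′ → head s < p) → All (λ u → head u < p) ρ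
tail-heads-< [-]           _  = []
tail-heads-< (_ ∷ ordered) <p = heads-< ordered (<p refl)

finalRows : Array → Rows
finalRows ρ = stateRows 0 (atCap 0 ρ)

finalRows-free : ∀ {p} ρ → 0 < p → All (λ u → head u < p) ρ → finalRows ρ p ≗ loop p
finalRows-free []      0<p []         j = cong (λ u → u j) (base-≰ (ℕP.<⇒≱ 0<p))
finalRows-free (r ∷ ρ) 0<p (r<p ∷ <p) j =
  trans (sym (≔-agree (finalRows ρ) (head r) _ _ (ℕP.<⇒≢ r<p ∘ sym) j)) (finalRows-free ρ 0<p <p j)

module _ {n : ℕ} where

  -- If the first part of s exceeds the length of r, both rows slide to e (head s ∸ 2).
  D-violation : ∀ {r ρ g} → Linked Below (r ∷ ρ) → All (InRange n ∘ head) (r ∷ ρ) →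
                (∀ p → 2 ≤ p → p ≤ head r → g p ≗ finalRows (r ∷ ρ) p) →
                ¬ Linked FirstAtMostLength (r ∷ ρ) → D n g ≡ 0ℤ
  D-violation {ρ = []} _ _ _ ¬lk = contradiction [-] ¬lk
  D-violation {r} {s@(suc (suc y) ∷ xs) ∷ ρ} {g} ((s<r , ℓs<ℓr) ∷ ordered)
              (rr ∷ rs@(s≤s (s≤s z≤n) , s≤s (s≤s y<n)) ∷ rρ) agree ¬lk
    with linked? (λ u v → head v ℕP.≤? length u) (s ∷ ρ)
  -- The violation lies further down. Agreement is demanded only up to the first part of the top
  -- row, so `r` can be forgotten without changing `g`.
  ... | no ¬lk′ = D-violation {g = g} ordered (rs ∷ rρ)
    (λ p 2≤p p≤s j → trans (agree p 2≤p (ℕP.≤-trans p≤s (ℕP.<⇒≤ s<r)) j)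
      (sym (≔-agree (finalRows (s ∷ ρ)) (head r) _ p (ℕP.<⇒≢ (ℕP.≤-<-trans p≤s s<r)) j))) ¬lk′
  ... | yes lk = begin
    D n g
      ≡⟨ D-slide {g = g} {g₁} rs (ℕP.≤-trans (ℕP.<⇒≤ ℓs<ℓr) ℓr≤y) (ℕP.<⇒≤ y<n)
           (λ p p≥ p< → ℕP.<⇒≢ p< , free p p≥ p<) (≔-agree g (head s) (e y)) gs (≔-on g (head s) (e y)) ⟩
    D n g₁
      ≡⟨ D-slide {g = g₁} {g₂} rr ℓr≤y (ℕP.<⇒≤ y<n)
           (λ p p≥ p< → ℕP.<⇒≢ (ℕP.<-trans p< s<r) , λ j →
             trans (sym (≔-agree g (head s) (e y) p (ℕP.<⇒≢ p<) j))
                   (free p (ℕP.≤-trans (s≤s (s≤s (ℕP.<⇒≤ ℓs<ℓr))) p≥) p< j))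
           (≔-agree g₁ (head r) (e y))
           (λ j → trans (sym (≔-agree g (head s) (e y) _ (ℕP.<⇒≢ s<r ∘ sym) j)) (gr j))
           (≔-on g₁ (head r) (e y)) ⟩
    D n g₂
      ≡⟨ D-equalRows {g = g₂} rr rs (ℕP.<⇒≢ s<r ∘ sym) (λ j → trans (≔-on g₁ (head r) (e y) j)
           (sym (trans (sym (≔-agree g₁ (head r) (e y) _ (ℕP.<⇒≢ s<r) j)) (≔-on g (head s) (e y) j)))) ⟩
    0ℤ ∎
    where
    open ≡-Reasoning
    ℓr = List.length (tail r)
    g₁ = g [ head s ≔ e y ]
    g₂ = g₁ [ head r ≔ e y ]
    ℓr≤y : ℓr ≤ y
    ℓr≤y = ℕ.s≤s⁻¹ (ℕ.s≤s⁻¹ (ℕP.≰⇒> λ s≤ → ¬lk (s≤ ∷ lk)))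
    -- Below `s` there is no violation, so the next first part is at most the length of `s`; the
    -- rows from `2 + length xs` up to that of `s` are therefore loop rows.
    ρ-first : ∀ {p u ρ′} → 2 ℕ.+ List.length xs ≤ p → ρ ≡ u ∷ ρ′ → head u < p
    ρ-first p≥ refl = ℕP.<-≤-trans (s≤s (Linked.head lk)) p≥
    free : ∀ p → 2 ℕ.+ List.length xs ≤ p → p < 2 ℕ.+ y → g p ≗ loop p
    free p p≥ p< j = begin
      g p j
        ≡⟨ agree p (ℕP.≤-trans (s≤s (s≤s z≤n)) p≥) (ℕP.<⇒≤ (ℕP.<-trans p< s<r)) j ⟩
      finalRows (r ∷ s ∷ ρ) p j
        ≡⟨ ≔-agree (finalRows (s ∷ ρ)) (head r) _ p (ℕP.<⇒≢ (ℕP.<-trans p< s<r)) j ⟨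
      finalRows (s ∷ ρ) p j
        ≡⟨ ≔-agree (finalRows ρ) (head s) _ p (ℕP.<⇒≢ p<) j ⟨
      finalRows ρ p j
        ≡⟨ finalRows-free ρ (ℕP.≤-trans (s≤s z≤n) p≥) (tail-heads-< ordered (ρ-first p≥)) j ⟩
      loop p j ∎
    gs : g (head s) ≗ e (List.length xs)
    gs j = trans (agree (head s) (s≤s (s≤s z≤n)) (ℕP.<⇒≤ s<r) j)
      (trans (sym (≔-agree (finalRows (s ∷ ρ)) (head r) _ (head s) (ℕP.<⇒≢ s<r) j)) (≔-on (finalRows ρ) (head s) _ j))
    gr : g (head r) ≗ e ℓr
    gr j = trans (agree (head r) (proj₁ rr) ℕP.≤-refl j) (≔-on (finalRows (s ∷ ρ)) (head r) _ j)

  -- Let `ℓ` be the tail length of the top row `r`. If `r` is too long, `e ℓ` meets only loop rows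
  -- and slides off, giving 0. Otherwise it slides to `e (head r ∸ 2)`, the path being clear by
  -- `FirstAtMostLength`; this is `loop (head r)` plus a vector that slides off, so `r` can be
  -- removed.
  D-final : ∀ ρ → Linked Below ρ → All (InRange n ∘ head) ρ → All (λ r → List.length (tail r) < n) ρ →
            Linked FirstAtMostLength ρ →
            (All (λ r → length r < head r) ρ × D n (finalRows ρ) ≡ 1ℤ) ⊎ (¬ All (λ r → length r < head r) ρ × D n (finalRows ρ) ≡ 0ℤ)
  D-final [] _ _ _ _ = inj₁ ([] , trans (D-cong n (finalRows []) loop λ i → finalRows-free {2 ℕ.+ i} [] (s≤s z≤n) []) (D-loop n))
  D-final (r@(suc (suc y) ∷ xs) ∷ ρ) ordered (rr@(s≤s (s≤s z≤n) , s≤s (s≤s y<n)) ∷ rρ) (ℓ<n ∷ ℓs) lk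
    with length r ℕP.<? head r
  ... | no r≮ = inj₂ ((λ { (r< ∷ _) → r≮ r< }) ,
    D-slideOff {g = finalRows (r ∷ ρ)} rr (ℕP.<⇒≤ ℓ<n)
      (λ p p≥ _ → let r<p = ℕP.≤-trans (s≤s (ℕP.≮⇒≥ r≮)) p≥ in ℕP.<⇒≢ r<p ∘ sym , λ j →
        trans (sym (≔-agree (finalRows ρ) (head r) _ p (ℕP.<⇒≢ r<p ∘ sym) j))
          (finalRows-free ρ (ℕP.≤-trans (s≤s z≤n) r<p) (All.tail (heads-< ordered r<p)) j))
      (≔-on (finalRows ρ) (head r) _))
  ... | yes r< = ⊎-map (λ (fl , eq) → r< ∷ fl , trans reduce eq) (λ (¬fl , eq) → ¬fl ∘ All.tail , trans reduce eq)
                   (D-final ρ (Linked.tail ordered) rρ ℓs (Linked.tail lk))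
    where
    open ≡-Reasoning
    k = head r
    g₁ = finalRows ρ [ k ≔ e y ]
    g₂ = finalRows ρ [ k ≔ e (suc y) ]
    ρ-first : ∀ {p u ρ′} → 2 ℕ.+ List.length xs ≤ p → ρ ≡ u ∷ ρ′ → head u < p
    ρ-first p≥ refl = ℕP.<-≤-trans (s≤s (Linked.head lk)) p≥
    agree : ∀ v w → AgreeOff k (finalRows ρ [ k ≔ v ]) (finalRows ρ [ k ≔ w ])
    agree v w p p≢k j = trans (sym (≔-agree (finalRows ρ) k v p p≢k j)) (≔-agree (finalRows ρ) k w p p≢k j)
    reduce : D n (finalRows (r ∷ ρ)) ≡ D n (finalRows ρ)
    reduce = begin
      D n (finalRows (r ∷ ρ))
        ≡⟨ D-slide {g = finalRows (r ∷ ρ)} {g₁} rr (ℕ.s≤s⁻¹ (ℕ.s≤s⁻¹ r<)) (ℕP.<⇒≤ y<n)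
             (λ p p≥ p< → ℕP.<⇒≢ p< , λ j → trans (sym (≔-agree (finalRows ρ) k _ p (ℕP.<⇒≢ p<) j))
               (finalRows-free ρ (ℕP.≤-trans (s≤s z≤n) p≥) (tail-heads-< ordered (ρ-first p≥)) j))
             (agree _ (e y)) (≔-on (finalRows ρ) k _) (≔-on (finalRows ρ) k (e y)) ⟩
      D n g₁
        ≡⟨ D-split {g = g₁} {finalRows ρ} {g₂} rr (record
             { off₁ = λ p p≢k j → sym (≔-agree (finalRows ρ) k (e y) p p≢k j)
             ; off₂ = agree (e y) (e (suc y))
             ; on   = λ j → trans (≔-on (finalRows ρ) k (e y) j) (trans (e-step y j) (sym (cong₂ _+_
                        (finalRows-free ρ (s≤s z≤n) (tail-heads-< ordered λ { refl → proj₁ (Linked.head ordered) }) j)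
                        (≔-on (finalRows ρ) k (e (suc y)) j)))) }) ⟩
      D n (finalRows ρ) + D n g₂
        ≡⟨ cong (λ z → D n (finalRows ρ) + z) (D-slideOff {g = g₂} rr y<n
             (λ p p> _ → ℕP.<⇒≢ p> ∘ sym , λ j → trans (sym (≔-agree (finalRows ρ) k _ p (ℕP.<⇒≢ p> ∘ sym) j))
               (finalRows-free ρ (ℕP.≤-trans (s≤s z≤n) p>) (All.tail (heads-< ordered p>)) j))
             (≔-on (finalRows ρ) k (e (suc y)))) ⟩
      D n (finalRows ρ) + 0ℤ
        ≡⟨ +-identityʳ _ ⟩
      D n (finalRows ρ) ∎

-- The induction over parts

prefix-snoc : ∀ {x xs ys} → Prefix _<_ xs ys → List.length xs < List.length ys → All (x <_) ys →
              Prefix _<_ (xs ++ x ∷ []) ys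
prefix-snoc {ys = _ ∷ _} []       _         (x<y ∷ _)  = x<y ∷ []
prefix-snoc              (p ∷ ps) (s≤s len) (_ ∷ x<ys) = p ∷ prefix-snoc ps len x<ys

linked-snoc : ∀ {c xs} → Linked _≥_ xs → All (c <_) xs → Linked _≥_ (xs ++ suc c ∷ [])
linked-snoc []       []           = [-]
linked-snoc [-]      (c<x ∷ [])   = c<x ∷ [-]
linked-snoc (p ∷ ps) (_ ∷ c<xs)   = p ∷ linked-snoc ps c<xs

linked-reverse : ∀ {A : Set} {R : A → A → Set} {xs} → Linked R xs → Linked (flip R) (reverse xs)
linked-reverse {xs = []}     _  = []
linked-reverse {A} {R} {x ∷ xs} lk = go lk [-]
  where
  go : ∀ {x xs acc} → Linked R (x ∷ xs) → Linked (flip R) (x ∷ acc) → Linked (flip R) (xs ʳ++ (x ∷ acc))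
  go [-]      acc = acc
  go (p ∷ lk) acc = go lk (p ∷ acc)

module _ {n : ℕ} where

  Admissible : ℕ → List Slot → Array → Set
  Admissible c σ π = (IsDescendingPlanePartition π × HasDimension (suc n) π) × Extends c σ π

  DetCounts : ℕ → List Slot → Set
  DetCounts c σ = Counted (Admissible c σ) (D n (stateRows c σ))

  admissible-⊎ : ∀ {k c σ c₁ σ₁ c₂ σ₂ z₁ z₂} → StateSplits k c σ c₁ σ₁ c₂ σ₂ →
           Counted (Admissible c₁ σ₁) z₁ → Counted (Admissible c₂ σ₂) z₂ → Counted (Admissible c σ) (z₁ + z₂)
  admissible-⊎ S = counted-⊎ (λ (dpp , x) → ⊎-map (dpp ,_) (dpp ,_) (to x))
    (λ (dpp , x) → dpp , from₁ x) (λ (dpp , x) → dpp , from₂ x) (λ (_ , x) (_ , y) → disjoint x y)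
    where open StateSplits S

  detCounts-split : ∀ {k c σ c₁ σ₁ c₂ σ₂} → InRange n k → StateSplits k c σ c₁ σ₁ c₂ σ₂ →
               DetCounts c₁ σ₁ → DetCounts c₂ σ₂ → DetCounts c σ
  detCounts-split r S G₁ G₂ = subst (Counted _) (sym (D-split r (StateSplits.splits S))) (admissible-⊎ S G₁ G₂)

  detCounts-∅ : ∀ {c σ} → (∀ {π} → ¬ Admissible c σ π) → D n (stateRows c σ) ≡ 0ℤ → DetCounts c σ
  detCounts-∅ ¬adm D≡0 = subst (Counted _) (sym D≡0) (counted-∅ ¬adm)

  -- Invariant of a slot whose known parts all exceed `c`; `fits` keeps the leading column of its
  -- row vector inside the matrix.
  record GoodRow (c : ℕ) (r : Row) : Set where
    field
      parts>  : All (c <_) (toList r)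
      weakly  : Linked _≥_ (toList r)
      inRange : InRange n (head r)
      fits    : List.length (tail r) < n

  open GoodRow
  open IsDescendingPlanePartition

  good-weaken : ∀ {c r} → GoodRow (suc c) r → GoodRow c r
  good-weaken g = record
    { parts> = All.map ℕP.<⇒≤ (parts> g) ; weakly = weakly g ; inRange = inRange g ; fits = fits g }

  head> : ∀ {c r} → GoodRow c r → c < head r
  head> {r = _ ∷ _} g = All.head (parts> g)

  columns⇒head< : ∀ {r s} → Linked _≥_ (toList r) → ColumnsDecrease r s → head s < head r
  columns⇒head< {_ ∷ _ ∷ _} {_ ∷ _} (a≥b ∷ _) (s<b ∷ _) = ℕP.<-≤-trans s<b a≥b

  heads-above : ∀ {c r As} → Linked (flip ColumnsDecrease) (r ∷ As) → All (GoodRow c) As →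
                All (λ t → head r < head t) As
  heads-above [-]       []       = []
  heads-above (cd ∷ lk) (g ∷ gs) = r<t ∷ All.map (ℕP.<-trans r<t) (heads-above lk gs)
    where r<t = columns⇒head< (weakly g) cd

  ≢-slots : ∀ {k b As} → All (λ t → k < head t) As → All (λ t → k ≢ head (proj₁ t)) (atCap b As)
  ≢-slots <As = map⁺ (All.map ℕP.<⇒≢ <As)

  -- The row vector starts beyond the last column, so the determinant is 0. The row would have
  -- length above `n` but first part at most `n + 1`, against `first>length`.
  detCounts-overflow : ∀ {c As r σ} → All (λ t → head r < head t) As → InRange n (head r) → n ≤ List.length (tail r) →
                  DetCounts c (atCap (suc c) As ʳ++ ((r , suc c) ∷ σ))
  detCounts-overflow {c} {As} {r} {σ} <As rr n≤ℓ = detCounts-∅ ¬adm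
    (D-zeroRow {g = stateRows c (τ ʳ++ ((r , suc c) ∷ σ))} rr λ j j<n → trans (cong (λ u → u j) (stateRows-ʳ++ τ (≢-slots <As)))
      (trans (≔-on (stateRows c σ) (head r) (vector (r , suc c)) j) (H-vanishes (suc c) _ j (ℕP.<-≤-trans j<n n≤ℓ))))
    where
    τ = atCap (suc c) As
    ¬adm : ∀ {π} → ¬ Admissible c (τ ʳ++ ((r , suc c) ∷ σ)) π
    ¬adm ((dpp , _) , x) with (_ , (ys , refl , _) , ℓ<h) ← extends-row τ x (first>length dpp) =
      ℕP.<-irrefl refl (ℕP.<-≤-trans (ℕP.<-≤-trans ℓ<h (ℕ.s≤s⁻¹ (proj₂ rr)))
        (s≤s (ℕP.≤-trans n≤ℓ (ℕP.≤-trans (ℕP.m≤m+n _ _) (ℕP.≤-reflexive (sym (length-++ (tail r))))))))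

  -- The last part `suc c` of `r` stands just past the known end of `t`, where `t` can only have
  -- parts up to `suc c`. Both slots have the same tail length and bound, so two rows of the matrix
  -- coincide.
  detCounts-collision : ∀ {c t As r σ} xs → toList r ≡ xs ++ suc c ∷ [] → List.length xs ≡ List.length (tail t) →
                   All (λ u → head t < head u) As → head r < head t → InRange n (head t) → InRange n (head r) →
                   DetCounts c (atCap (suc c) (t ∷ As) ʳ++ ((r , suc c) ∷ σ))
  detCounts-collision {c} {t} {As} {r@(a ∷ as)} {σ} xs r≡ len <As r<t rt rr = detCounts-∅ ¬adm
    (D-equalRows {g = stateRows c (atCap (suc c) (t ∷ As) ʳ++ ((r , suc c) ∷ σ))} rt rr (ℕP.<⇒≢ r<t ∘ sym) λ j → begin
      stateRows c (τ ʳ++ ((t , suc c) ∷ (r , suc c) ∷ σ)) (head t) j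
        ≡⟨ cong (λ u → u j) (stateRows-ʳ++ τ (≢-slots <As)) ⟩
      stateRows c ((t , suc c) ∷ (r , suc c) ∷ σ) (head t) j
        ≡⟨ ≔-on (stateRows c ((r , suc c) ∷ σ)) (head t) _ j ⟩
      H (suc c) (List.length (tail t)) j
        ≡⟨ cong (λ ℓ → H (suc c) ℓ j) (trans (sym len) len-r) ⟩
      H (suc c) (List.length as) j
        ≡⟨ ≔-on (stateRows c σ) (head r) _ j ⟨
      stateRows c ((r , suc c) ∷ σ) (head r) j
        ≡⟨ cong (λ u → u j) (stateRows-ʳ++ (atCap (suc c) (t ∷ As)) (≢-slots (r<t ∷ All.map (ℕP.<-trans r<t) <As))) ⟨
      stateRows c (atCap (suc c) (t ∷ As) ʳ++ ((r , suc c) ∷ σ)) (head r) j ∎)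
    where
    open ≡-Reasoning
    τ = atCap (suc c) As
    len-r : List.length xs ≡ List.length as
    len-r = ℕP.suc-injective (sym (trans (cong List.length r≡) (trans (length-++ xs) (ℕP.+-comm _ 1))))
    ¬adm : ∀ {π} → ¬ Admissible c (τ ʳ++ ((t , suc c) ∷ (r , suc c) ∷ σ)) π
    ¬adm ((dpp , _) , x)
      with (_ , _ , (ys , refl , lk) , (zs , refl , _) , cd) ← extends-adjacent τ x (colsDecrease dpp) =
      collision xs len (subst (λ us → Prefix _<_ us (tail t ++ ys))
        (trans (cong (_++ zs) r≡) (ListP.++-assoc xs _ zs)) cd) lk

  module _ {c : ℕ} (next : ∀ ρ → All (GoodRow c) ρ → Linked ColumnsDecrease ρ → DetCounts c (atCap c ρ)) where

    -- As holds the rows above r, nearest first; the rows B below r take no further part suc c.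
    slots : Array → Row → Array → List Slot
    slots As r B = atCap (suc c) As ʳ++ ((r , suc c) ∷ atCap c B)

    -- The case where `r` takes no further `suc c` enters as the parameter `stopped`; this separates
    -- the recursion along one row from the recursion over the rows.
    module _ (As B : Array) (gAs : All (GoodRow (suc c)) As)
             (stopped : ∀ r → GoodRow c r → Linked (flip ColumnsDecrease) (r ∷ As) → Linked ColumnsDecrease (r ∷ B) →
                        DetCounts c (atCap (suc c) As ʳ++ ((r , c) ∷ atCap c B))) where

      -- Copies of `suc c` are appended to `r` one at a time; `room` bounds their number and makes
      -- the recursion terminate.
      grow : ∀ r → GoodRow c r → Linked (flip ColumnsDecrease) (r ∷ As) → Linked ColumnsDecrease (r ∷ B) →
             ∀ room → suc (List.length (tail r)) ℕ.+ room ≡ n → DetCounts c (slots As r B)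
      grow r gr up down room eq = detCounts-split (inRange gr)
        (stateSplits-ʳ++ (atCap (suc c) As) (≢-slots (heads-above up gAs)) (row-splits c r c (atCap c B)))
        (stopped r gr up down) (extended room eq)
        where
        r′ = r ⁺++ (suc c ∷ [])
        length-r′ : List.length (tail r′) ≡ suc (List.length (tail r))
        length-r′ = trans (length-++ (tail r)) (ℕP.+-comm _ 1)
        weaken : ∀ {B} → Linked ColumnsDecrease (r ∷ B) → Linked ColumnsDecrease (r′ ∷ B)
        weaken [-]       = [-]
        weaken (cd ∷ lk) = (cd ++ᵖ _) ∷ lk
        lengthen : ∀ {As} → All (GoodRow (suc c)) As → Linked (flip ColumnsDecrease) (r ∷ As) →
                   DetCounts c (slots As r′ B) ⊎ Linked (flip ColumnsDecrease) (r′ ∷ As)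
        lengthen {[]}     []         [-]       = inj₂ [-]
        -- The new part collides exactly when the tail of `t` is used up. Otherwise it lies under a
        -- known part of `t`, which exceeds `suc c` because `t` has not been offered `suc c` yet.
        lengthen {t ∷ As} (gt ∷ gAs) (cd ∷ up) with suc (List.length (tail r)) ℕP.≟ List.length (tail t)
        ... | yes len = inj₁ (detCounts-collision {t = t} {As} {r′} (toList r) refl len (heads-above up gAs)
                          (columns⇒head< (weakly gt) cd) (inRange gt) (inRange gr))
        ... | no len≢ = inj₂
          (prefix-snoc cd (ℕP.≤∧≢⇒< (length-mono cd) len≢) (All.tail (parts> gt)) ∷ up)
        extended : ∀ room → suc (List.length (tail r)) ℕ.+ room ≡ n → DetCounts c (slots As r′ B)
        extended zero       eq = detCounts-overflow (heads-above up gAs) (inRange gr)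
          (ℕP.≤-reflexive (trans (sym eq) (trans (ℕP.+-identityʳ _) (sym length-r′))))
        extended (suc room) eq with lengthen gAs up
        ... | inj₁ collided = collided
        ... | inj₂ up′      = grow r′ gr′ up′ (weaken down) room room-eq
          where
          room-eq : suc (List.length (tail r′)) ℕ.+ room ≡ n
          room-eq = trans (cong (λ ℓ → suc ℓ ℕ.+ room) length-r′) (trans (sym (ℕP.+-suc _ room)) eq)
          gr′ : GoodRow c r′
          gr′ = record
            { parts>  = ++⁺ (parts> gr) (ℕP.≤-refl ∷ [])
            ; weakly  = linked-snoc (weakly gr) (parts> gr)
            ; inRange = inRange gr
            ; fits    = ℕP.≤-trans (ℕP.m≤m+n _ room) (ℕP.≤-reflexive room-eq)
            }

    -- Once `r` is finished with `suc c` it joins `B` with bound `c`, and the row directly above it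
    -- is next.
    sweep : ∀ As r B → All (GoodRow (suc c)) As → GoodRow c r → All (GoodRow c) B →
            Linked (flip ColumnsDecrease) (r ∷ As) → Linked ColumnsDecrease (r ∷ B) → DetCounts c (slots As r B)
    sweep As r B gAs gr gB up down =
      grow As B gAs (stopped As gAs) r gr up down (n ℕ.∸ suc (List.length (tail r))) (ℕP.m+[n∸m]≡n (fits gr))
      where
      stopped : ∀ As → All (GoodRow (suc c)) As →
                ∀ r → GoodRow c r → Linked (flip ColumnsDecrease) (r ∷ As) → Linked ColumnsDecrease (r ∷ B) →
                DetCounts c (atCap (suc c) As ʳ++ ((r , c) ∷ atCap c B))
      stopped []       _          r gr _         down = next (r ∷ B) (gr ∷ gB) down
      stopped (t ∷ As) (gt ∷ gAs) r gr (cd ∷ up) down =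
        sweep As t (r ∷ B) gAs (good-weaken gt) (gr ∷ gB) up (cd ∷ down)

  below : ∀ {c ρ} → All (GoodRow c) ρ → Linked ColumnsDecrease ρ → Linked Below ρ
  below _        []        = []
  below _        [-]       = [-]
  below (g ∷ gs) (cd ∷ lk) = (columns⇒head< (weakly g) cd , length-mono cd) ∷ below gs lk

  -- Positive parts bounded by 0 do not exist, so no row can grow and no row can be added.
  extends-0 : ∀ ρ {π} → Extends 0 (atCap 0 ρ) π → AllParts (0 <_) π → π ≡ ρ
  extends-0 []      (stop {[]} _ _)                      _            = refl
  extends-0 []      (stop {(_ ∷ _) ∷ _} (1>a ∷ _) _)     ((a>0 ∷ _) ∷ _) = contradiction a>0 (ℕP.<⇒≱ 1>a)
  extends-0 (r ∷ ρ) (([] , refl , _) ∷ x)                (_ ∷ pos)    =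
    cong₂ _∷_ (cong (head r ∷_) (ListP.++-identityʳ (tail r))) (extends-0 ρ x pos)
  extends-0 (r ∷ ρ) ((y ∷ ys , refl , 0≥y ∷ _) ∷ _)      ((_ ∷ pos) ∷ _) =
    contradiction (All.head (++⁻ʳ (tail r) pos)) (ℕP.≤⇒≯ 0≥y)

  final : ∀ ρ → All (GoodRow 0) ρ → Linked ColumnsDecrease ρ → DetCounts 0 (atCap 0 ρ)
  final ρ gs lk with linked? (λ r s → head s ℕP.≤? length r) ρ
  ... | no ¬first≤ = detCounts-∅ (λ ((dpp , _) , x) →
          ¬first≤ (subst (Linked _) (extends-0 ρ x (positive dpp)) (first≤previous dpp)))
        (violation ρ (below gs lk) (All.map inRange gs) ¬first≤)
    where
    violation : ∀ ρ → Linked Below ρ → All (InRange n ∘ head) ρ → ¬ Linked FirstAtMostLength ρ → D n (finalRows ρ) ≡ 0ℤ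
    violation []      _       _  ¬first≤ = contradiction [] ¬first≤
    violation (r ∷ ρ) ordered rs ¬first≤ = D-violation {g = finalRows (r ∷ ρ)} ordered rs (λ _ _ _ _ → refl) ¬first≤
  ... | yes first≤ with D-final ρ (below gs lk) (All.map inRange gs) (All.map fits gs) first≤
  ...   | inj₂ (¬first> , D≡0) = detCounts-∅ (λ ((dpp , _) , x) →
          ¬first> (subst (All _) (extends-0 ρ x (positive dpp)) (first>length dpp))) D≡0
  ...   | inj₁ (first> , D≡1) = subst (Counted _) (sym D≡1) (counted-singleton {π₀ = ρ}
          ((record
            { positive       = All.map parts> gs
            ; rowsDecrease   = All.map weakly gs
            ; colsDecrease   = lk
            ; first>length   = first>
            ; first≤previous = first≤
            } , All.map bounded gs) , extends-self ρ)
          (λ ((dpp , _) , x) → extends-0 ρ x (positive dpp)))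
    where
    bounded : ∀ {r} → GoodRow 0 r → All (_≤ suc n) (toList r)
    bounded {a ∷ as} g = All.map (λ x≤a → ℕP.≤-trans x≤a (ℕ.s≤s⁻¹ (proj₂ (inRange g))))
      (Linked⇒All (flip ℕP.≤-trans) ℕP.≤-refl (weakly g))
    extends-self : ∀ ρ → Extends 0 (atCap 0 ρ) ρ
    extends-self []      = stop [-] []
    extends-self (r ∷ ρ) = ([] , cong (head r ∷_) (sym (ListP.++-identityʳ (tail r))) , [-]) ∷ extends-self ρ

  -- To pass from `c` to `suc c`, first decide whether a new row starts with `suc c`, then sweep
  -- upwards from the last row.
  level : ∀ c → c ≤ suc n → ∀ ρ → All (GoodRow c) ρ → Linked ColumnsDecrease ρ → DetCounts c (atCap c ρ)
  level zero    _     ρ gs lk = final ρ gs lk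
  level (suc c) 1+c≤m ρ gs lk =
    -- The decisions begin at the last row, so the rows are reversed; the equation undoes the double
    -- reversal.
    subst (DetCounts (suc c))
      (trans (sym (ListP.map-ʳ++ (_, suc c) (reverse ρ))) (cong (atCap (suc c)) (ListP.reverse-involutive ρ)))
      (choose (reverse ρ) c 1+c≤m (level c (ℕP.<⇒≤ 1+c≤m)) (All.tabulate (All.lookup gs ∘ reverse⁻)) (linked-reverse lk))
    where
    Next : ℕ → Set
    Next c = ∀ ρ → All (GoodRow c) ρ → Linked ColumnsDecrease ρ → DetCounts c (atCap c ρ)

    without : ∀ As c → Next c → All (GoodRow (suc c)) As → Linked (flip ColumnsDecrease) As → DetCounts c (atCap (suc c) As ʳ++ [])
    without []       c next _          _  = next [] [] []
    without (t ∷ As) c next (gt ∷ gAs) up = sweep next As t [] gAs (good-weaken gt) [] up [-]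

    with-row : ∀ As c → 1 ≤ c → suc c ≤ suc n → Next c → All (GoodRow (suc c)) As → Linked (flip ColumnsDecrease) As →
               DetCounts c (atCap (suc c) As ʳ++ (((suc c ∷ []) , suc c) ∷ []))
    with-row As c 1≤c (s≤s c≤n) next gAs up = go As gAs up
      where
      1≤n : 1 ≤ n
      1≤n = ℕP.≤-trans 1≤c c≤n
      rr : InRange n (suc c)
      rr = s≤s 1≤c , s≤s (s≤s c≤n)
      start : ∀ As → All (GoodRow (suc c)) As → Linked (flip ColumnsDecrease) ((suc c ∷ []) ∷ As) →
              DetCounts c (atCap (suc c) As ʳ++ (((suc c ∷ []) , suc c) ∷ []))
      start As gAs up = sweep next As (suc c ∷ []) [] gAs
        (record { parts> = ℕP.≤-refl ∷ [] ; weakly = [-] ; inRange = rr ; fits = 1≤n })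
        [] up [-]
      go : ∀ As → All (GoodRow (suc c)) As → Linked (flip ColumnsDecrease) As →
           DetCounts c (atCap (suc c) As ʳ++ (((suc c ∷ []) , suc c) ∷ []))
      go []       _          _  = start [] [] [-]
      -- A new row starts one column to the right of `t`, so its first part collides if `t` has an
      -- empty tail.
      go (t ∷ As) (gt ∷ gAs) up with 0 ℕP.≟ List.length (tail t)
      ... | yes len = detCounts-collision {t = t} {As} {suc c ∷ []} [] refl len (heads-above up gAs) (head> gt) (inRange gt) rr
      ... | no len≢ = start (t ∷ As) (gt ∷ gAs)
        (prefix-snoc [] (ℕP.≤∧≢⇒< z≤n len≢) (All.tail (parts> gt)) ∷ up)

    choose : ∀ As c → suc c ≤ suc n → Next c → All (GoodRow (suc c)) As → Linked (flip ColumnsDecrease) As →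
             DetCounts (suc c) (atCap (suc c) As ʳ++ [])
    -- No row can start with 1, since its first part must exceed its length; accordingly the matrix
    -- has no row of index 1 and the determinant does not change.
    choose As zero c<m next gAs up = subst (Counted _)
      (trans (+-identityʳ _) (sym (D-cong n (stateRows 1 (τ ʳ++ [])) (stateRows 0 (τ ʳ++ [])) λ i → Splits.off₁ (splits S) (2 ℕ.+ i) λ ())))
      (admissible-⊎ S (without As 0 next gAs up) (counted-∅ ¬adm))
      where
      open StateSplits
      τ = atCap 1 As
      S = stateSplits-ʳ++ τ (≢-slots (All.map head> gAs)) (newRow-splits 0)
      ¬adm : ∀ {π} → ¬ Admissible 0 (τ ʳ++ (((1 ∷ []) , 1) ∷ [])) π
      ¬adm ((dpp , _) , x) with (_ , (_ , refl , _) , s≤s ()) ← extends-row τ x (first>length dpp)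
    choose As (suc c) c<m next gAs up = detCounts-split (s≤s (s≤s z≤n) , s≤s c<m)
      (stateSplits-ʳ++ (atCap _ As) (≢-slots (All.map head> gAs)) (newRow-splits (suc c)))
      (without As (suc c) next gAs up) (with-row As (suc c) (s≤s z≤n) c<m next gAs up)

  -- With nothing decided, the state imposes no restriction: a first part is at most the previous
  -- length, which is less than the previous first part, so first parts decrease.
  counted-dpp : Counted (λ π → IsDescendingPlanePartition π × HasDimension (suc n) π) (D n (base (suc n)))
  counted-dpp = counted-⇔ (λ { {π} (dpp , dim) → (dpp , dim) , stop (heads π dpp dim) (rowsDecrease dpp) })
    proj₁ (level (suc n) ℕP.≤-refl [] [] [])
    where
    linked-heads : ∀ {r π} → Linked (λ r s → head s ≤ length r) (r ∷ π) → All (λ r → length r < head r) (r ∷ π) →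
                   Linked _>_ (map head (r ∷ π))
    linked-heads [-]       _          = [-]
    linked-heads (s≤ ∷ lk) (r> ∷ rs>) = ℕP.≤-<-trans s≤ r> ∷ linked-heads lk rs>
    heads : ∀ π → IsDescendingPlanePartition π → HasDimension (suc n) π → Linked _>_ (suc (suc n) ∷ map head π)
    heads []            dpp dim               = [-]
    heads ((_ ∷ _) ∷ π) dpp ((a≤m ∷ _) ∷ dim) = s≤s a≤m ∷ linked-heads (first≤previous dpp) (first>length dpp)

-- From enumeration to bijection, and the entries of the matrix

_≟ʳ_ : DecidableEquality Row
(x ∷ xs) ≟ʳ (y ∷ ys) = map′ (λ { (refl , refl) → refl }) (λ { refl → refl , refl })
  (x ℕP.≟ y ×-dec ListP.≡-dec ℕP._≟_ xs ys)

lookup-injective : ∀ {A : Set} {xs : List A} → Unique xs → ∀ i j → List.lookup xs i ≡ List.lookup xs j → i ≡ j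
lookup-injective (_  ∷ _)  zero    zero    _  = refl
lookup-injective (x∉ ∷ _)  zero    (suc j) eq = contradiction eq (All.lookup x∉ (∈-lookup j))
lookup-injective (x∉ ∷ _)  (suc i) zero    eq = contradiction (sym eq) (All.lookup x∉ (∈-lookup i))
lookup-injective (_  ∷ xs) (suc i) (suc j) eq = cong suc (lookup-injective xs i j eq)

counted⇒↔ : ∀ {P z} → Counted P z → ∃[ N ] ((Fin N ↔ Refinement Array P) × + N ≡ z)
counted⇒↔ {P} E = List.length arrays , mk↔ₛ′ to from
  (λ (π , [ Pπ ]) → value-injective (sym (lookup-index (member π Pπ))))
  (λ i → lookup-injective unique _ i (sym (lookup-index (member (List.lookup arrays i) (sound (∈-lookup i)))))) , size
  where
  open Counted E
  -- The witness in a refinement is irrelevant; decidable equality of arrays allows membership to be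
  -- recomputed from it.
  member : ∀ π → .(P π) → π ∈ arrays
  member π Pπ = recompute (any? (ListP.≡-dec _≟ʳ_ π) arrays) (complete Pπ)
  to : Fin (List.length arrays) → Refinement Array P
  to i = List.lookup arrays i , [ sound (∈-lookup i) ]
  from : Refinement Array P → Fin (List.length arrays)
  from (π , [ Pπ ]) = Any.index (member π Pπ)

δ≡e : ∀ i j → δ i j ≡ e i j
δ≡e zero    zero    = refl
δ≡e zero    (suc j) = refl
δ≡e (suc i) zero    = refl
δ≡e (suc i) (suc j) = δ≡e i j

-- For `i < n` row `2 + i` is undecided, and its multiset coefficient is the binomial of the entry
-- by `mset≡C`.
base≡entry : ∀ n i j → i < n → base (suc n) (2 ℕ.+ i) j ≡ entry (suc i) (suc j)
base≡entry n i j i<n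
  rewrite base-≤ {suc n} {2 ℕ.+ i} (s≤s i<n) | mset≡C (suc i) j | ℕP.+-suc i j | ℕP.+-comm i 1
        | δ≡e i j | δ≡e (suc i) j
  = solve 3 (λ a b c → a :- b :+ c := c :+ a :- b) refl (e i j) (e (suc i) j) _

corollary7 : (m : ℕ) → 1 ≤ m →
    ∃[ N ] ((Fin N ↔ DPP m) × (+ N ≡ det (dppMatrix (m ∸ 1))))
corollary7 (suc n) (s≤s z≤n) with N , dpps , N≡D ← counted⇒↔ (counted-dpp {n}) =
  N , dpps , trans N≡D (det-cong λ i j → base≡entry n (toℕ i) (toℕ j) (toℕ<n i))
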